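{- Let $P\subseteq\mathbb{R}^d$ be a $d$-dimensional lattice polytope and let $\operatorname{Pyr}(P)=\operatorname{conv}(P\times\{1\},\{0\})\subseteq\mathbb{R}^d\times\mathbb{R}$ be the lattice pyramid over $P$. Then $$\mu^F(\operatorname{Pyr}(P))=\max\{2,\ \mu^F(P)+1\}.$$
   Context: For a $d$-dimensional rational polytope $P\subseteq\mathbb{R}^d$ and $a\in(\mathbb{Z}^d)^*$ let $h_P(a)=\min_{x\in P}\langle a,x\rangle$. For $s>0$ the Fine adjoint polytope is $P^{F(s)}=\{x\in\mathbb{R}^d : \langle a,x\rangle\ge h_P(a)+s \text{ for all } a\in(\mathbb{Z}^d)^*\setminus\{0\}\}$. The Fine $\mathbb{Q}$-codegree is $\mu^F(P)=(\sup\{s>0 : P^{F(s)}\neq\emptyset\})^{ -1}$. A lattice polytope has vertices in $\mathbb{Z}^d$. -}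

module Defs where

open import Algebra.Bundles using (CommutativeRing)
import Algebra.Construct.NaturalChoice.Max as Max
import Algebra.Properties.CommutativeMonoid.Sum as Sum
import Algebra.Properties.Semiring.Mult as Mult
import Data.Vec.Functional.Relation.Binary.Equality.Setoid as VecEq
open import Data.Fin.Base using (Fin)
open import Data.Integer.Base using (ℤ; +_; -[1+_]; 0ℤ)
open import Data.Nat.Base using (ℕ; suc)
open import Data.Product.Base using (_×_; ∃; ∃-syntax)
open import Data.Sum.Base using (_⊎_)
open import Data.Vec.Functional using (Vector; _∷_; map; replicate)
open import Level using (0ℓ) renaming (suc to lsuc)
open import Relation.Binary.Bundles using (DecTotalOrder; TotalOrder)
open import Relation.Binary.Core using (Rel)
open import Relation.Binary.PropositionalEquality.Core using (_≡_)
open import Relation.Binary.Structures using (IsDecTotalOrder)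
open import Relation.Nullary.Negation.Core using (¬_)
open import Relation.Unary using (Pred; _∈_; _≐_; Satisfiable)

-- The classical real numbers, given by their axioms; these determine ℝ up to
-- isomorphism.  The operations _⁻¹ and sup are total.  Where inversion or the
-- supremum is not defined they take the value 0 (for sup ∅ the value is left
-- open), so that 1/∞ is read as 0.
record CompleteOrderedField : Set (lsuc 0ℓ) where
  infix  4 _≤_ _<_
  infix  8 _⁻¹

  field
    commutativeRing : CommutativeRing 0ℓ 0ℓ

  open CommutativeRing commutativeRing public

  field
    _≤_             : Rel Carrier 0ℓ
    isDecTotalOrder : IsDecTotalOrder _≈_ _≤_
    +-monoˡ-≤       : ∀ z {x y} → x ≤ y → x + z ≤ y + z
    *-nonNegative   : ∀ {x y} → 0# ≤ x → 0# ≤ y → 0# ≤ x * y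

    0≉1       : ¬ (0# ≈ 1#)
    _⁻¹       : Carrier → Carrier
    *-inverse : ∀ {x} → ¬ (x ≈ 0#) → x * x ⁻¹ ≈ 1#
    0⁻¹≈0     : ∀ {x} → x ≈ 0# → x ⁻¹ ≈ 0#

  _<_ : Rel Carrier 0ℓ
  x < y = x ≤ y × ¬ (x ≈ y)

  UpperBound : Pred Carrier 0ℓ → Pred Carrier 0ℓ
  UpperBound S u = ∀ x → x ∈ S → x ≤ u

  field
    sup           : Pred Carrier 0ℓ → Carrier
    sup-upper     : ∀ S → Satisfiable S → Satisfiable (UpperBound S) →
                    UpperBound S (sup S)
    sup-least     : ∀ S → Satisfiable S → Satisfiable (UpperBound S) →
                    ∀ u → UpperBound S u → sup S ≤ u
    sup-unbounded : ∀ S → ¬ Satisfiable (UpperBound S) → sup S ≈ 0#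

  decTotalOrder : DecTotalOrder 0ℓ 0ℓ 0ℓ
  decTotalOrder = record { isDecTotalOrder = isDecTotalOrder }

  totalOrder : TotalOrder 0ℓ 0ℓ 0ℓ
  totalOrder = DecTotalOrder.totalOrder decTotalOrder

  open Max totalOrder public using (_⊔_)

module Polytopes (ℝ : CompleteOrderedField) where

  open CompleteOrderedField ℝ
  open Sum +-commutativeMonoid public using (sum)
  open Mult semiring using () renaming (_×_ to _·_)
  open VecEq setoid public using (_≋_)

  Point : ℕ → Set
  Point = Vector Carrier

  Subset : ℕ → Set (lsuc 0ℓ)
  Subset d = Pred (Point d) 0ℓ

  fromℤ : ℤ → Carrier
  fromℤ (+ n)    = n · 1#
  fromℤ -[1+ n ] = - (suc n · 1#)

  -- The dual lattice (ℤ^d)* is identified with ℤ^d via the dual basis.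
  ⟨_,_⟩ : ∀ {d} → Vector ℤ d → Point d → Carrier
  ⟨ a , x ⟩ = sum λ i → fromℤ (a i) * x i

  combination : ∀ {d n} → Vector Carrier n → Vector (Point d) n → Point d
  combination w p i = sum λ j → w j * p j i

  conv : ∀ {d} → Subset d → Subset d
  conv S x = ∃[ n ] ∃[ p ] ∃[ w ]
      (∀ (j : Fin n) → p j ∈ S)
    × (∀ j → 0# ≤ w j)
    × sum w ≈ 1#
    × x ≋ combination w p

  aff : ∀ {d} → Subset d → Subset d
  aff S x = ∃[ n ] ∃[ p ] ∃[ w ]
      (∀ (j : Fin n) → p j ∈ S)
    × sum w ≈ 1#
    × x ≋ combination w p

  IsPolytope : ∀ {d} → Subset d → Set
  IsPolytope {d} P = ∃[ n ] ∃ λ (v : Vector (Point d) n) →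
    P ≐ conv (λ x → ∃[ j ] x ≋ v j)

  FullDimensional : ∀ {d} → Subset d → Set
  FullDimensional P = ∀ x → x ∈ aff P

  -- Vertices as extreme points.
  Vertex : ∀ {d} → Subset d → Subset d
  Vertex P v = v ∈ P ×
    (∀ x y t → x ∈ P → y ∈ P → 0# < t → t < 1# →
      v ≋ (λ i → (1# - t) * x i + t * y i) → x ≋ v × y ≋ v)

  IsLatticePoint : ∀ {d} → Subset d
  IsLatticePoint x = ∃[ z ] x ≋ map fromℤ z

  IsLatticePolytope : ∀ {d} → Subset d → Set
  IsLatticePolytope P = IsPolytope P × (∀ v → v ∈ Vertex P → IsLatticePoint v)

  -- IsSupportValue P a h says that h = h_P(a).
  IsSupportValue : ∀ {d} → Subset d → Vector ℤ d → Carrier → Set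
  IsSupportValue P a h =
      (∃[ x ] x ∈ P × ⟨ a , x ⟩ ≈ h)
    × (∀ x → x ∈ P → h ≤ ⟨ a , x ⟩)

  fineAdjoint : ∀ {d} → Subset d → Carrier → Subset d
  fineAdjoint P s x = ∀ a → ¬ (∀ i → a i ≡ 0ℤ) →
    ∃[ h ] IsSupportValue P a h × h + s ≤ ⟨ a , x ⟩

  μF : ∀ {d} → Subset d → Carrier
  μF P = sup (λ s → 0# < s × Satisfiable (fineAdjoint P s)) ⁻¹

  -- ℝ^d × ℝ is identified with ℝ^(d+1) by putting the last factor first:
  -- (x , t) is t ∷ x.
  Pyr : ∀ {d} → Subset d → Subset (suc d)
  Pyr {d} P = conv λ q →
    (∃[ x ] x ∈ P × q ≋ (1# ∷ x)) ⊎ q ≋ replicate (suc d) 0#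

-- A point (t , y) of the fine adjoint of Pyr P at level s satisfies
-- s ≤ t ≤ 1 - s, by the functionals ±t.  Since h_P(a) is an integer for a
-- lattice polytope P, (- h_P(a) , a) is also an admissible functional; it is
-- nonnegative on Pyr P, so y / t lies in the fine adjoint of P at level
-- s / t ≥ s / (1 - s).  Conversely, if s ≤ 1 and x lies in the fine adjoint of
-- P at level s, then t = 1 / (1 + s) gives the point (t , t x) of the fine
-- adjoint of Pyr P at level s / (1 + s).  The supremum for Pyr P is therefore
-- min (1/2 , σ / (1 + σ)), where σ is the supremum for P.

module Submission where

open import Defs
open import Algebra.Solver.Ring.AlmostCommutativeRing
  using (fromCommutativeRing; _-Raw-AlmostCommutative⟶_)
import Algebra.Construct.NaturalChoice.Max as MaxProperties
import Algebra.Properties.Ring as RingProperties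
import Algebra.Properties.Semiring.Mult as Mult
import Algebra.Properties.Semiring.Sum as SemiringSum
import Algebra.Solver.Ring as RingSolver
open import Data.Empty using (⊥-elim)
open import Data.Fin.Base using (Fin; zero; suc)
open import Data.Fin.Properties using (¬∀⟶∃¬; all?)
open import Data.Integer.Base as ℤ using (ℤ; +_; -[1+_]; 0ℤ; _⊖_)
import Data.Integer.Properties as ℤₚ
open import Data.Maybe.Base using (just; nothing)
open import Data.Nat.Base as ℕ using (ℕ; zero; suc)
import Data.Nat.Properties as ℕₚ
open import Data.Product.Base using (_×_; _,_; proj₁; proj₂; ∃-syntax)
import Data.Sign.Base as Sign
open import Data.Sum.Base using (_⊎_; inj₁; inj₂; [_,_]′)
open import Data.Unit.Base using (⊤)
open import Data.Vec.Functional using (Vector; _∷_; tail; map; replicate)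
open import Function.Base using (_∘_; case_of_)
open import Relation.Binary.Definitions using (WeaklyDecidable)
import Relation.Binary.PropositionalEquality.Core as ≡
open import Relation.Binary.Structures using (IsDecTotalOrder)
open import Relation.Nullary using (¬_; yes; no)
open import Relation.Unary using (Satisfiable; _≐_)
open ≡ using (_≡_)

-- The totalised `sup` shapes the proof: its axioms speak only of inhabited bounded sets, so both
-- properties must be shown for the levels of `P`. A positive level exists because full dimension
-- gives one constant bounding the width of `P` from below in all of the infinitely many integral
-- directions at once; boundedness comes from a coordinate functional and its negative. In dimension
-- 0 there is no nonzero functional, every positive level is admissible and `μF P` takes the default
-- value 0, so that case is separate. The restriction `s ≤ 1` is harmless: admissible levels are
-- closed downwards, so a level above 1 makes 1 admissible, which already yields the value 1/2.
-- Integrality of the support function takes an argument because lattice polytopes are defined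
-- through extreme points: a minimiser of the functional has to be chosen extreme, which a
-- lexicographic tie-break achieves.

module PyramidCodegree (ℝ : CompleteOrderedField) where

  open CompleteOrderedField ℝ hiding (zero)
  open Polytopes ℝ
  open IsDecTotalOrder isDecTotalOrder public
    using (_≤?_; _≟_; total; antisym; ≤-respˡ-≈; ≤-respʳ-≈)
    renaming (refl to ≤-refl; trans to ≤-trans; reflexive to ≤-reflexive)
  open RingProperties ring
    using (-0#≈0#; x∙y⁻¹≈ε⇒x≈y; -‿involutive; -‿+-comm; -‿distribˡ-*; -‿distribʳ-*)
  open Mult semiring using (×-homo-+; ×1-homo-*; ×-congˡ) renaming (_×_ to _·_)

  private
    infixr 5 _⟫_
    _⟫_ : ∀ {x y z} → x ≈ y → y ≈ z → x ≈ z
    _⟫_ = trans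

  -- The embedding of the integers

  fromℤ-neg : ∀ z → fromℤ (ℤ.- z) ≈ - fromℤ z
  fromℤ-neg (+ zero)  = sym -0#≈0#
  fromℤ-neg (+ suc n) = refl
  fromℤ-neg -[1+ n ]  = sym (-‿involutive _)

  fromℤ-⊖ : ∀ m n → fromℤ (m ⊖ n) ≈ m · 1# - n · 1#
  fromℤ-⊖ m       zero    = sym (+-congˡ -0#≈0# ⟫ +-identityʳ _)
  fromℤ-⊖ zero    (suc n) = sym (+-identityˡ _)
  fromℤ-⊖ (suc m) (suc n) =
    reflexive (≡.cong fromℤ (ℤₚ.[1+m]⊖[1+n]≡m⊖n m n))
    ⟫ fromℤ-⊖ m n
    ⟫ +-congʳ (sym (+-identityʳ _) ⟫ +-congˡ (sym (-‿inverseʳ 1#))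
               ⟫ sym (+-assoc _ _ _) ⟫ +-congʳ (+-comm _ _))
    ⟫ +-assoc _ _ _
    ⟫ +-congˡ (-‿+-comm _ _)

  fromℤ-+ : ∀ x y → fromℤ (x ℤ.+ y) ≈ fromℤ x + fromℤ y
  fromℤ-+ (+ m)    (+ n)    = ×-homo-+ 1# m n
  fromℤ-+ (+ m)    -[1+ n ] = fromℤ-⊖ m (suc n)
  fromℤ-+ -[1+ m ] (+ n)    = fromℤ-⊖ n (suc m) ⟫ +-comm _ _
  fromℤ-+ -[1+ m ] -[1+ n ] =
    -‿cong (×-congˡ (≡.cong suc (≡.sym (ℕₚ.+-suc m n))) ⟫ ×-homo-+ 1# (suc m) (suc n))
    ⟫ sym (-‿+-comm _ _)

  fromℤ-◃- : ∀ n → fromℤ (Sign.- ℤ.◃ n) ≈ - (n · 1#)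
  fromℤ-◃- zero    = sym -0#≈0#
  fromℤ-◃- (suc n) = refl

  fromℤ-* : ∀ x y → fromℤ (x ℤ.* y) ≈ fromℤ x * fromℤ y
  fromℤ-* (+ m)    (+ n)    = reflexive (≡.cong fromℤ (ℤₚ.+◃n≡+n (m ℕ.* n))) ⟫ ×1-homo-* m n
  fromℤ-* (+ m)    -[1+ n ] =
    fromℤ-◃- (m ℕ.* suc n) ⟫ -‿cong (×1-homo-* m (suc n)) ⟫ -‿distribʳ-* _ _
  fromℤ-* -[1+ m ] (+ n)    =
    fromℤ-◃- (suc m ℕ.* n) ⟫ -‿cong (×1-homo-* (suc m) n) ⟫ -‿distribˡ-* _ _
  fromℤ-* -[1+ m ] -[1+ n ] =
    ×1-homo-* (suc m) (suc n) ⟫ sym (-‿involutive _) ⟫ -‿cong (-‿distribˡ-* _ _) ⟫ -‿distribʳ-* _ _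

  -- Agrees with fromℤ but sends 1 to 1# on the nose, where fromℤ gives
  -- 1# + 0#; the solver can then match literal occurrences of 1#.
  coefficient : ℤ → Carrier
  coefficient (+ 1)    = 1#
  coefficient z        = fromℤ z

  coefficient≈fromℤ : ∀ z → coefficient z ≈ fromℤ z
  coefficient≈fromℤ (+ 0)           = refl
  coefficient≈fromℤ (+ 1)           = sym (+-identityʳ 1#)
  coefficient≈fromℤ (+ suc (suc n)) = refl
  coefficient≈fromℤ -[1+ n ]        = refl

  private
    coefficientMorphism : ℤ.+-*-rawRing -Raw-AlmostCommutative⟶ fromCommutativeRing commutativeRing
    coefficientMorphism = record
      { ⟦_⟧    = coefficient
      ; +-homo = λ x y → coefficient≈fromℤ (x ℤ.+ y) ⟫ fromℤ-+ x y
                 ⟫ sym (+-cong (coefficient≈fromℤ x) (coefficient≈fromℤ y))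
      ; *-homo = λ x y → coefficient≈fromℤ (x ℤ.* y) ⟫ fromℤ-* x y
                 ⟫ sym (*-cong (coefficient≈fromℤ x) (coefficient≈fromℤ y))
      ; -‿homo = λ x → coefficient≈fromℤ (ℤ.- x) ⟫ fromℤ-neg x ⟫ sym (-‿cong (coefficient≈fromℤ x))
      ; 0-homo = refl
      ; 1-homo = refl
      }

    coefficient≟ : WeaklyDecidable (λ x y → coefficient x ≈ coefficient y)
    coefficient≟ x y with x ℤₚ.≟ y
    ... | yes x≡y = just (reflexive (≡.cong coefficient x≡y))
    ... | no  _   = nothing

  module Solver =
    RingSolver ℤ.+-*-rawRing (fromCommutativeRing commutativeRing) coefficientMorphism coefficient≟
  open Solver using (solve; _:=_; _:+_; _:*_; _:-_; :-_; con)

  -- Order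

  x≤y⇒0≤y-x : ∀ {x y} → x ≤ y → 0# ≤ y - x
  x≤y⇒0≤y-x {x} x≤y = ≤-respˡ-≈ (-‿inverseʳ x) (+-monoˡ-≤ (- x) x≤y)

  ≤-by-difference : ∀ {x y z} → 0# ≤ z → y - x ≈ z → x ≤ y
  ≤-by-difference {x} {y} {z} 0≤z y-x≈z =
    ≤-respˡ-≈ (+-identityˡ x) (≤-respʳ-≈ eq (+-monoˡ-≤ x 0≤z))
    where
    eq : z + x ≈ y
    eq = +-congʳ (sym y-x≈z) ⟫ solve 2 (λ x y → y :- x :+ x := y) refl x y

  0≤x+y : ∀ {x y} → 0# ≤ x → 0# ≤ y → 0# ≤ x + y
  0≤x+y {x} {y} 0≤x 0≤y = ≤-trans 0≤y (≤-respˡ-≈ (+-identityˡ y) (+-monoˡ-≤ y 0≤x))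

  ≰⇒≥ : ∀ {x y} → ¬ x ≤ y → y ≤ x
  ≰⇒≥ {x} {y} x≰y with total x y
  ... | inj₁ x≤y = ⊥-elim (x≰y x≤y)
  ... | inj₂ y≤x = y≤x

  0≤1 : 0# ≤ 1#
  0≤1 with total 0# 1#
  ... | inj₁ 0≤1 = 0≤1
  ... | inj₂ 1≤0 = ≤-by-difference (*-nonNegative (x≤y⇒0≤y-x 1≤0) (x≤y⇒0≤y-x 1≤0))
    (solve 0 (con (+ 1) :- con (+ 0) := (con (+ 0) :- con (+ 1)) :* (con (+ 0) :- con (+ 1))) refl)

  1≰0 : ¬ 1# ≤ 0#
  1≰0 1≤0 = 0≉1 (antisym 0≤1 1≤0)

  0<1 : 0# < 1#
  0<1 = 0≤1 , 0≉1

  0<⇒*⁻¹ : ∀ {x} → 0# < x → x * x ⁻¹ ≈ 1#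
  0<⇒*⁻¹ (_ , 0≉x) = *-inverse (0≉x ∘ sym)

  0≤⁻¹ : ∀ {x} → 0# < x → 0# ≤ x ⁻¹
  0≤⁻¹ {x} 0<x with total 0# (x ⁻¹)
  ... | inj₁ 0≤x⁻¹ = 0≤x⁻¹
  ... | inj₂ x⁻¹≤0 = ⊥-elim (1≰0 (≤-by-difference (*-nonNegative (proj₁ 0<x) (x≤y⇒0≤y-x x⁻¹≤0))
    (+-congˡ (-‿cong (sym (0<⇒*⁻¹ 0<x)))
     ⟫ solve 2 (λ x y → con (+ 0) :- x :* y := x :* (con (+ 0) :- y)) refl x (x ⁻¹))))

  0<⁻¹ : ∀ {x} → 0# < x → 0# < x ⁻¹
  0<⁻¹ {x} 0<x = 0≤⁻¹ 0<x , λ 0≈x⁻¹ → 0≉1 (sym (zeroʳ x) ⟫ *-congˡ 0≈x⁻¹ ⟫ 0<⇒*⁻¹ 0<x)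

  *-cancelˡ-0≤ : ∀ {x y} → 0# < x → 0# ≤ x * y → 0# ≤ y
  *-cancelˡ-0≤ {x} {y} 0<x 0≤xy =
    ≤-respʳ-≈ (solve 3 (λ x y z → z :* (x :* y) := (x :* z) :* y) refl x y (x ⁻¹)
               ⟫ *-congʳ (0<⇒*⁻¹ 0<x) ⟫ *-identityˡ y)
              (*-nonNegative (0≤⁻¹ 0<x) 0≤xy)

  0<-≤-trans : ∀ {x y} → 0# < x → x ≤ y → 0# < y
  0<-≤-trans (0≤x , 0≉x) x≤y =
    ≤-trans 0≤x x≤y , λ 0≈y → 0≉x (antisym 0≤x (≤-respʳ-≈ (sym 0≈y) x≤y))

  -- If `x * y` vanished, so would `x * (0# - y)`; cancelling `x` would give `0# ≤ 0# - y`, hence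
  -- `y ≈ 0#`.
  0<* : ∀ {x y} → 0# < x → 0# < y → 0# < x * y
  0<* {x} {y} 0<x (0≤y , 0≉y) = *-nonNegative (proj₁ 0<x) 0≤y , λ 0≈xy →
    0≉y (antisym 0≤y (≤-by-difference (*-cancelˡ-0≤ 0<x
      (≤-respʳ-≈ (0≈xy′ 0≈xy) ≤-refl)) refl))
    where
    0≈xy′ : 0# ≈ x * y → 0# ≈ x * (0# - y)
    0≈xy′ 0≈xy = solve 0 (con (+ 0) := con (+ 0) :- con (+ 0)) refl ⟫ +-congˡ (-‿cong 0≈xy)
      ⟫ solve 2 (λ x y → con (+ 0) :- x :* y := x :* (con (+ 0) :- y)) refl x y

  -- Lets the ring solver work modulo a hypothesis `u ≈ v`: the solver proves an identity with the
  -- correction `k * (u - v)`, and this lemma discards the correction.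
  absorb : ∀ {u v} k z → u ≈ v → z + k * (u - v) ≈ z
  absorb {u} {v} k z u≈v =
    +-congˡ (*-congˡ (+-congʳ u≈v ⟫ -‿inverseʳ v) ⟫ zeroʳ k) ⟫ +-identityʳ z

  0≤n·1 : ∀ n → 0# ≤ n · 1#
  0≤n·1 zero    = ≤-refl
  0≤n·1 (suc n) = 0≤x+y 0≤1 (0≤n·1 n)

  1≤[1+n]·1 : ∀ n → 1# ≤ suc n · 1#
  1≤[1+n]·1 n = ≤-by-difference (0≤n·1 n) (solve 1 (λ x → con (+ 1) :+ x :- con (+ 1) := x) refl _)

  -- Discreteness of the integers, the source of every bound that is uniform over the nonzero
  -- functionals.
  nonZero⇒1≤∣fromℤ∣ : ∀ z → ¬ z ≡ 0ℤ → 1# ≤ fromℤ z ⊎ 1# ≤ - fromℤ z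
  nonZero⇒1≤∣fromℤ∣ (+ zero)  z≢0 = ⊥-elim (z≢0 ≡.refl)
  nonZero⇒1≤∣fromℤ∣ (+ suc n) _   = inj₁ (1≤[1+n]·1 n)
  nonZero⇒1≤∣fromℤ∣ -[1+ n ]  _   = inj₂ (≤-respʳ-≈ (sym (-‿involutive _)) (1≤[1+n]·1 n))

  -- Sums

  open SemiringSum semiring
    using (*-distribˡ-sum; *-distribʳ-sum; ∑-distrib-+; ∑-comm; sum-cong-≋; sum-replicate-zero)

  +-mono-≤ : ∀ {x y u v} → x ≤ y → u ≤ v → x + u ≤ y + v
  +-mono-≤ {x} {y} {u} {v} x≤y u≤v = ≤-by-difference (0≤x+y (x≤y⇒0≤y-x x≤y) (x≤y⇒0≤y-x u≤v))
    (solve 4 (λ x y u v → y :+ v :- (x :+ u) := (y :- x) :+ (v :- u)) refl x y u v)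

  *-monoˡ-≤ : ∀ {k x y} → 0# ≤ k → x ≤ y → k * x ≤ k * y
  *-monoˡ-≤ {k} {x} {y} 0≤k x≤y = ≤-by-difference (*-nonNegative 0≤k (x≤y⇒0≤y-x x≤y))
    (solve 3 (λ k x y → k :* y :- k :* x := k :* (y :- x)) refl k x y)

  sum-mono-≤ : ∀ {n} {f g : Vector Carrier n} → (∀ i → f i ≤ g i) → sum f ≤ sum g
  sum-mono-≤ {zero}  f≤g = ≤-refl
  sum-mono-≤ {suc n} f≤g = +-mono-≤ (f≤g zero) (sum-mono-≤ (f≤g ∘ suc))

  0≤sum : ∀ {n} {f : Vector Carrier n} → (∀ i → 0# ≤ f i) → 0# ≤ sum f
  0≤sum {n} 0≤f = ≤-respˡ-≈ (sum-replicate-zero n) (sum-mono-≤ 0≤f)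

  term≤sum : ∀ {n} {f : Vector Carrier n} → (∀ i → 0# ≤ f i) → ∀ i → f i ≤ sum f
  term≤sum 0≤f zero    = ≤-respˡ-≈ (+-identityʳ _) (+-mono-≤ ≤-refl (0≤sum (0≤f ∘ suc)))
  term≤sum 0≤f (suc i) = ≤-respˡ-≈ (+-identityˡ _) (+-mono-≤ (0≤f zero) (term≤sum (0≤f ∘ suc) i))

  weighted-constant : ∀ {n} (w : Vector Carrier n) → sum w ≈ 1# → ∀ c → sum (λ j → w j * c) ≈ c
  weighted-constant w ∑w≈1 c = sym (*-distribʳ-sum c w) ⟫ *-congʳ ∑w≈1 ⟫ *-identityˡ c

  weighted-shift : ∀ {n} (w f : Vector Carrier n) → sum w ≈ 1# → ∀ c →
    sum (λ j → w j * (f j - c)) ≈ sum (λ j → w j * f j) - c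
  weighted-shift w f ∑w≈1 c =
    sum-cong-≋ (λ j → distribˡ (w j) (f j) (- c))
    ⟫ ∑-distrib-+ (λ j → w j * f j) (λ j → w j * - c) ⟫ +-congˡ (weighted-constant w ∑w≈1 (- c))

  weighted-≥ : ∀ {n} {w f : Vector Carrier n} {m} → (∀ j → 0# ≤ w j) → sum w ≈ 1# →
    (∀ j → m ≤ f j) → m ≤ sum (λ j → w j * f j)
  weighted-≥ {w = w} 0≤w ∑w≈1 m≤f =
    ≤-respˡ-≈ (weighted-constant w ∑w≈1 _) (sum-mono-≤ (λ j → *-monoˡ-≤ (0≤w j) (m≤f j)))

  weighted-≤ : ∀ {n} {w f : Vector Carrier n} {m} → (∀ j → 0# ≤ w j) → sum w ≈ 1# →
    (∀ j → f j ≤ m) → sum (λ j → w j * f j) ≤ m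
  weighted-≤ {w = w} 0≤w ∑w≈1 f≤m =
    ≤-respʳ-≈ (weighted-constant w ∑w≈1 _) (sum-mono-≤ (λ j → *-monoˡ-≤ (0≤w j) (f≤m j)))

  -- The pairing with integral functionals

  pairing-cong : ∀ {d} (a : Vector ℤ d) {x y : Point d} → x ≋ y → ⟨ a , x ⟩ ≈ ⟨ a , y ⟩
  pairing-cong a x≋y = sum-cong-≋ (λ i → *-congˡ (x≋y i))

  pairing-combination : ∀ {d n} (a : Vector ℤ d) (w : Vector Carrier n) (p : Vector (Point d) n) →
    ⟨ a , combination w p ⟩ ≈ sum (λ j → w j * ⟨ a , p j ⟩)
  pairing-combination a w p =
    sum-cong-≋ (λ i → *-distribˡ-sum (fromℤ (a i)) (λ j → w j * p j i))
    ⟫ ∑-comm (λ i j → fromℤ (a i) * (w j * p j i))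
    ⟫ sum-cong-≋ (λ j →
        sum-cong-≋ (λ i →
          solve 3 (λ a w p → a :* (w :* p) := w :* (a :* p)) refl (fromℤ (a i)) (w j) (p j i))
        ⟫ sym (*-distribˡ-sum (w j) (λ i → fromℤ (a i) * p j i)))

  pairing-+ : ∀ {d} (a : Vector ℤ d) (x y : Point d) →
    ⟨ a , (λ i → x i + y i) ⟩ ≈ ⟨ a , x ⟩ + ⟨ a , y ⟩
  pairing-+ a x y = sum-cong-≋ (λ i → distribˡ (fromℤ (a i)) (x i) (y i))
    ⟫ ∑-distrib-+ (λ i → fromℤ (a i) * x i) (λ i → fromℤ (a i) * y i)

  pairing-scale : ∀ {d} (a : Vector ℤ d) t (x : Point d) →
    ⟨ a , (λ i → t * x i) ⟩ ≈ t * ⟨ a , x ⟩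
  pairing-scale a t x =
    sum-cong-≋ (λ i →
      solve 3 (λ a t x → a :* (t :* x) := t :* (a :* x)) refl (fromℤ (a i)) t (x i))
    ⟫ sym (*-distribˡ-sum t (λ i → fromℤ (a i) * x i))

  pairing-zeroʳ : ∀ {d} (a : Vector ℤ d) → ⟨ a , replicate d 0# ⟩ ≈ 0#
  pairing-zeroʳ {d} a = sum-cong-≋ (λ i → zeroʳ (fromℤ (a i))) ⟫ sum-replicate-zero d

  pairing-zeroˡ : ∀ {d} {a : Vector ℤ d} → (∀ i → a i ≡ 0ℤ) → ∀ x → ⟨ a , x ⟩ ≈ 0#
  pairing-zeroˡ {d} a≡0 x =
    sum-cong-≋ (λ i → *-congʳ (reflexive (≡.cong fromℤ (a≡0 i))) ⟫ zeroˡ (x i)) ⟫ sum-replicate-zero d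

  basis : ∀ {d} → Fin d → Point d
  basis zero    = 1# ∷ replicate _ 0#
  basis (suc i) = 0# ∷ basis i

  pairing-basis : ∀ {d} (a : Vector ℤ d) i → ⟨ a , basis i ⟩ ≈ fromℤ (a i)
  pairing-basis a zero    = +-cong (*-identityʳ _) (pairing-zeroʳ (tail a)) ⟫ +-identityʳ _
  pairing-basis a (suc i) = +-cong (zeroʳ _) (pairing-basis (tail a) i) ⟫ +-identityˡ _

  pairing-integral : ∀ {d} (a z : Vector ℤ d) → ∃[ k ] fromℤ k ≈ ⟨ a , map fromℤ z ⟩
  pairing-integral {zero}  a z = 0ℤ , refl
  pairing-integral {suc d} a z with pairing-integral (tail a) (tail z)
  ... | k , eq = a zero ℤ.* z zero ℤ.+ k , fromℤ-+ (a zero ℤ.* z zero) k ⟫ +-cong (fromℤ-* (a zero) (z zero)) eq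

  -- Convex hulls

  ∈-conv : ∀ {d} (S : Subset d) {x} → S x → conv S x
  ∈-conv S {x} x∈S =
    1 , (λ _ → x) , (λ _ → 1#) , (λ _ → x∈S) , (λ _ → 0≤1) , +-identityʳ 1# ,
    λ i → sym (+-identityʳ _ ⟫ *-identityˡ (x i))

  conv-≥ : ∀ {d} (S : Subset d) (a : Vector ℤ d) {m} → (∀ y → S y → m ≤ ⟨ a , y ⟩) →
    ∀ {x} → conv S x → m ≤ ⟨ a , x ⟩
  conv-≥ S a m≤ (_ , p , w , p∈S , 0≤w , ∑w≈1 , x≋) =
    ≤-respʳ-≈ (sym (pairing-cong a x≋ ⟫ pairing-combination a w p))
              (weighted-≥ 0≤w ∑w≈1 (λ j → m≤ (p j) (p∈S j)))

  conv-≤ : ∀ {d} (S : Subset d) (a : Vector ℤ d) {m} → (∀ y → S y → ⟨ a , y ⟩ ≤ m) →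
    ∀ {x} → conv S x → ⟨ a , x ⟩ ≤ m
  conv-≤ S a ≤m (_ , p , w , p∈S , 0≤w , ∑w≈1 , x≋) =
    ≤-respˡ-≈ (sym (pairing-cong a x≋ ⟫ pairing-combination a w p))
              (weighted-≤ 0≤w ∑w≈1 (λ j → ≤m (p j) (p∈S j)))

  -- Lexicographic order

  -- The lexicographic cone: convex, total and free of lines. The last property fails for a
  -- half-space, and it is what makes minimisers extreme.
  LexNonNegative : ∀ {n} → Vector Carrier n → Set
  LexNonNegative {zero}  z = ⊤
  LexNonNegative {suc n} z = 0# < z zero ⊎ (0# ≈ z zero × LexNonNegative (tail z))

  lex-cong : ∀ {n} {z z′ : Vector Carrier n} → z ≋ z′ → LexNonNegative z → LexNonNegative z′
  lex-cong {zero}  z≋ _ = _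
  lex-cong {suc n} z≋ (inj₁ (0≤z , 0≉z)) =
    inj₁ (≤-respʳ-≈ (z≋ zero) 0≤z , λ 0≈z′ → 0≉z (0≈z′ ⟫ sym (z≋ zero)))
  lex-cong {suc n} z≋ (inj₂ (0≈z , lex)) = inj₂ (0≈z ⟫ z≋ zero , lex-cong (z≋ ∘ suc) lex)

  lex-head : ∀ {n} (z : Vector Carrier (suc n)) → LexNonNegative z → 0# ≤ z zero
  lex-head z (inj₁ (0≤z , _)) = 0≤z
  lex-head z (inj₂ (0≈z , _)) = ≤-reflexive 0≈z

  lex-zero : ∀ n → LexNonNegative (replicate n 0#)
  lex-zero zero    = _
  lex-zero (suc n) = inj₂ (refl , lex-zero n)

  0<x+y : ∀ {x y} → 0# < x → 0# ≤ y → 0# < x + y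
  0<x+y {x} 0<x 0≤y = 0<-≤-trans 0<x (≤-respˡ-≈ (+-identityʳ x) (+-mono-≤ ≤-refl 0≤y))

  lex-+ : ∀ {n} {z z′ : Vector Carrier n} →
    LexNonNegative z → LexNonNegative z′ → LexNonNegative (λ i → z i + z′ i)
  lex-+ {zero}  _ _ = _
  lex-+ {suc n} {z′ = z′} (inj₁ 0<z) lex′ = inj₁ (0<x+y 0<z (lex-head z′ lex′))
  lex-+ {suc n} (inj₂ (0≈z , _)) (inj₁ 0<z′) =
    inj₁ (0<-≤-trans 0<z′ (≤-reflexive (sym (+-congʳ (sym 0≈z) ⟫ +-identityˡ _))))
  lex-+ {suc n} (inj₂ (0≈z , lex)) (inj₂ (0≈z′ , lex′)) =
    inj₂ (sym (+-identityˡ 0#) ⟫ +-cong 0≈z 0≈z′ , lex-+ lex lex′)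

  lex-scale : ∀ {n} {z : Vector Carrier n} {c} → 0# ≤ c → LexNonNegative z →
    LexNonNegative (λ i → c * z i)
  lex-scale {n} {z} {c} 0≤c lex with 0# ≟ c
  ... | yes 0≈c = lex-cong (λ i → sym (zeroˡ (z i)) ⟫ *-congʳ 0≈c) (lex-zero n)
  ... | no  0≉c = positive lex
    where
    positive : ∀ {n} {z : Vector Carrier n} → LexNonNegative z → LexNonNegative (λ i → c * z i)
    positive {zero}  _ = _
    positive {suc n} (inj₁ 0<z)         = inj₁ (0<* (0≤c , 0≉c) 0<z)
    positive {suc n} (inj₂ (0≈z , lex)) = inj₂ (sym (zeroʳ c) ⟫ *-congˡ 0≈z , positive lex)

  lex-combination : ∀ {n k} {w : Vector Carrier k} {z : Vector (Vector Carrier n) k} →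
    (∀ j → 0# ≤ w j) → (∀ j → LexNonNegative (z j)) → LexNonNegative (combination w z)
  lex-combination {n} {zero}  0≤w lex = lex-zero n
  lex-combination {n} {suc k} 0≤w lex =
    lex-+ (lex-scale (0≤w zero) (lex zero)) (lex-combination (0≤w ∘ suc) (lex ∘ suc))

  infixl 6 _⊝_
  _⊝_ : ∀ {n} → Vector Carrier n → Vector Carrier n → Vector Carrier n
  (x ⊝ y) i = x i - y i

  lex-total : ∀ {n} (x y : Vector Carrier n) → LexNonNegative (x ⊝ y) ⊎ LexNonNegative (y ⊝ x)
  lex-total {zero}  x y = inj₁ _
  lex-total {suc n} x y with x zero ≟ y zero
  ... | yes x≈y with lex-total (tail x) (tail y)
  ...   | inj₁ lex = inj₁ (inj₂ (sym (-‿inverseʳ _) ⟫ +-congʳ (sym x≈y) , lex))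
  ...   | inj₂ lex = inj₂ (inj₂ (sym (-‿inverseʳ _) ⟫ +-congʳ x≈y , lex))
  lex-total {suc n} x y | no x≉y with total (x zero) (y zero)
  ... | inj₁ x≤y = inj₂ (inj₁ (x≤y⇒0≤y-x x≤y , λ 0≈ → x≉y (sym (x∙y⁻¹≈ε⇒x≈y _ _ (sym 0≈)))))
  ... | inj₂ y≤x = inj₁ (inj₁ (x≤y⇒0≤y-x y≤x , λ 0≈ → x≉y (x∙y⁻¹≈ε⇒x≈y _ _ (sym 0≈))))

  lex-minimum : ∀ {n k} (v : Vector (Vector Carrier n) (suc k)) →
    ∃[ j ] ∀ i → LexNonNegative (v i ⊝ v j)
  lex-minimum {n} {zero} v = zero , λ { zero → lex-cong (λ i → sym (-‿inverseʳ _)) (lex-zero n) }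
  lex-minimum {n} {suc k} v with lex-minimum (tail v)
  ... | j , min with lex-total (v zero) (v (suc j))
  ...   | inj₁ lex = suc j , λ { zero → lex ; (suc i) → min i }
  ...   | inj₂ lex = zero , λ
    { zero    → lex-cong (λ i → sym (-‿inverseʳ _)) (lex-zero n)
    ; (suc i) → lex-cong
        (λ l → solve 3 (λ x y z → x :- y :+ (y :- z) := x :- z) refl
                 (v (suc i) l) (v (suc j) l) (v zero l))
        (lex-+ (min i) lex)
    }

  *-cancel-≈0 : ∀ {x y} → 0# < x → x * y ≈ 0# → y ≈ 0#
  *-cancel-≈0 {x} {y} 0<x xy≈0 =
    sym (solve 3 (λ x y z → z :* (x :* y) := (x :* z) :* y) refl x y (x ⁻¹)
         ⟫ *-congʳ (0<⇒*⁻¹ 0<x) ⟫ *-identityˡ y)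
    ⟫ *-congˡ xy≈0 ⟫ zeroʳ _

  x+y≈0⇒x≈0 : ∀ {x y} → 0# ≤ x → 0# ≤ y → x + y ≈ 0# → x ≈ 0#
  x+y≈0⇒x≈0 {x} 0≤x 0≤y x+y≈0 =
    antisym (≤-respˡ-≈ (+-identityʳ x) (≤-respʳ-≈ x+y≈0 (+-mono-≤ ≤-refl 0≤y))) 0≤x

  -- In the leading coordinate two nonnegative terms add up to zero, so both vanish and the
  -- lexicographic condition passes to the tails.
  lex-pointed : ∀ {n} (z z′ : Vector Carrier n) {s t} → LexNonNegative z → LexNonNegative z′ →
    0# < s → 0# < t → (∀ i → s * z i + t * z′ i ≈ 0#) → ∀ i → z i ≈ 0#
  lex-pointed {suc n} z z′ {s} {t} lex lex′ 0<s 0<t eq = λ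
    { zero    → z₀≈0
    ; (suc i) → lex-pointed (tail z) (tail z′) (lex-tail z z₀≈0 lex) (lex-tail z′ z′₀≈0 lex′) 0<s 0<t (eq ∘ suc) i
    }
    where
    0≤sz  = *-nonNegative (proj₁ 0<s) (lex-head z lex)
    0≤tz′ = *-nonNegative (proj₁ 0<t) (lex-head z′ lex′)
    z₀≈0 : z zero ≈ 0#
    z₀≈0 = *-cancel-≈0 0<s (x+y≈0⇒x≈0 0≤sz 0≤tz′ (eq zero))
    z′₀≈0 : z′ zero ≈ 0#
    z′₀≈0 = *-cancel-≈0 0<t (x+y≈0⇒x≈0 0≤tz′ 0≤sz (+-comm _ _ ⟫ eq zero))
    lex-tail : ∀ (z : Vector Carrier (suc n)) → z zero ≈ 0# → LexNonNegative z → LexNonNegative (tail z)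
    lex-tail z z≈0 (inj₁ (_ , 0≉z)) = ⊥-elim (0≉z (sym z≈0))
    lex-tail z z≈0 (inj₂ (_ , lex)) = lex

  -- Support functions of lattice polytopes

  -- Lexicographic comparison of graphs refines comparison by `⟨ a , _ ⟩`; the coordinates of `x`
  -- break the ties along the face where the functional is minimal.
  graph : ∀ {d} → Vector ℤ d → Point d → Vector Carrier (suc d)
  graph a x = ⟨ a , x ⟩ ∷ x

  graph-cong : ∀ {d} (a : Vector ℤ d) {x y} → x ≋ y → graph a x ≋ graph a y
  graph-cong a x≋y zero    = pairing-cong a x≋y
  graph-cong a x≋y (suc i) = x≋y i

  graph-combination : ∀ {d n} (a : Vector ℤ d) (w : Vector Carrier n) p →
    graph a (combination w p) ≋ combination w (graph a ∘ p)
  graph-combination a w p zero    = pairing-combination a w p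
  graph-combination a w p (suc i) = refl

  graph-affine : ∀ {d} (a : Vector ℤ d) s t (x y : Point d) i →
    graph a (λ i → s * x i + t * y i) i ≈ s * graph a x i + t * graph a y i
  graph-affine a s t x y zero    =
    pairing-+ a (λ i → s * x i) (λ i → t * y i) ⟫ +-cong (pairing-scale a s x) (pairing-scale a t y)
  graph-affine a s t x y (suc i) = refl

  lex-conv : ∀ {d} (S : Subset d) (a : Vector ℤ d) u → (∀ y → S y → LexNonNegative (graph a y ⊝ u)) →
    ∀ {x} → conv S x → LexNonNegative (graph a x ⊝ u)
  lex-conv S a u lex (_ , p , w , p∈S , 0≤w , ∑w≈1 , x≋) = lex-cong
    (λ i → weighted-shift w (λ j → graph a (p j) i) ∑w≈1 (u i)
           ⟫ +-congʳ (sym (graph-cong a x≋ i ⟫ graph-combination a w p i)))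
    (lex-combination {z = λ j → graph a (p j) ⊝ u} 0≤w (λ j → lex (p j) (p∈S j)))

  conv-inhabited : ∀ {d} (S : Subset d) {x} → conv S x → Satisfiable S
  conv-inhabited S (zero  , _ , _ , _ , _ , 0≈1 , _)   = ⊥-elim (0≉1 0≈1)
  conv-inhabited S (suc _ , p , _ , p∈S , _ , _ , _) = p zero , p∈S zero

  fullDimensional⇒inhabited : ∀ {d} (P : Subset d) → FullDimensional P → Satisfiable P
  fullDimensional⇒inhabited P full with full (replicate _ 0#)
  ... | zero  , _ , _ , _   , 0≈1 , _ = ⊥-elim (0≉1 0≈1)
  ... | suc _ , p , _ , p∈P , _   , _ = p zero , p∈P zero

  Generated : ∀ {d n} → Vector (Point d) n → Subset d
  Generated v x = ∃[ j ] x ≋ v j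

  -- If `v` lies strictly between `x` and `y`, the graph differences of `x` and `y` from `v` are
  -- lexicographically nonnegative and have a vanishing positive combination, so pointedness makes
  -- both zero.
  lexMinimum⇒vertex : ∀ {d} (P : Subset d) (a : Vector ℤ d) v → P v →
    (∀ x → P x → LexNonNegative (graph a x ⊝ graph a v)) → Vertex P v
  lexMinimum⇒vertex P a v v∈P min = v∈P , λ x y t x∈P y∈P 0<t (t≤1 , t≉1) v≋ →
    let 0<1-t : 0# < 1# - t
        0<1-t = x≤y⇒0≤y-x t≤1 , λ 0≈1-t → t≉1 (sym (x∙y⁻¹≈ε⇒x≈y 1# t (sym 0≈1-t)))
        g = graph a
        balance : ∀ i → (1# - t) * (g x i - g v i) + t * (g y i - g v i) ≈ 0#
        balance i =
          solve 4 (λ t x y v → (con (+ 1) :- t) :* (x :- v) :+ t :* (y :- v)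
                               := ((con (+ 1) :- t) :* x :+ t :* y) :- v) refl t (g x i) (g y i) (g v i)
          ⟫ +-congʳ (sym (graph-cong a v≋ i ⟫ graph-affine a (1# - t) t x y i))
          ⟫ -‿inverseʳ (g v i)
    in (λ i → x∙y⁻¹≈ε⇒x≈y _ _ (lex-pointed (g x ⊝ g v) (g y ⊝ g v) (min x x∈P) (min y y∈P)
                                  0<1-t 0<t balance (suc i)))
     , (λ i → x∙y⁻¹≈ε⇒x≈y _ _ (lex-pointed (g y ⊝ g v) (g x ⊝ g v) (min y y∈P) (min x x∈P)
                                  0<t 0<1-t (λ i → +-comm _ _ ⟫ balance i) (suc i)))

  -- The form in which integrality of the vertices is used later: the minimum is attained, and `k`
  -- can serve as a coordinate of an integral functional on the pyramid.
  HasIntegralSupport : ∀ {d} → Subset d → Set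
  HasIntegralSupport P = ∀ a → ∃[ k ] IsSupportValue P a (fromℤ k)

  -- Among the generators, one that lexicographically minimises
  -- (⟨ a , x ⟩ , x) is an extreme point, hence a lattice point, at which
  -- ⟨ a , _ ⟩ is minimal.
  latticePolytope⇒integralSupport : ∀ {d} (P : Subset d) → IsLatticePolytope P → Satisfiable P →
    HasIntegralSupport P
  latticePolytope⇒integralSupport P ((n , v , P⊆ , P⊇) , lattice) (x₀ , x₀∈P)
    with n | v | conv-inhabited (Generated v) (P⊆ x₀∈P) | P⊆ | P⊇
  ... | zero  | _ | _ , () , _ | _ | _
  ... | suc n | v | _ | P⊆ | P⊇ = support
    where
    support : HasIntegralSupport P
    support a with lex-minimum (graph a ∘ v)
    ... | j , min = k , (v j , v∈P , sym k≈) , λ x x∈P →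
      ≤-respˡ-≈ (sym k≈) (≤-by-difference (lex-head (graph a x ⊝ graph a (v j)) (minP x x∈P)) refl)
      where
      v∈P : P (v j)
      v∈P = P⊇ (∈-conv (Generated v) (j , λ _ → refl))
      minP : ∀ x → P x → LexNonNegative (graph a x ⊝ graph a (v j))
      minP x x∈P = lex-conv (Generated v) a (graph a (v j))
        (λ { y (i , y≋) → lex-cong (λ l → +-congʳ { - graph a (v j) l} (sym (graph-cong a y≋ l))) (min i) }) (P⊆ x∈P)
      z  = proj₁ (lattice (v j) (lexMinimum⇒vertex P a (v j) v∈P minP))
      v≋ = proj₂ (lattice (v j) (lexMinimum⇒vertex P a (v j) v∈P minP))
      k  = proj₁ (pairing-integral a z)
      k≈ : fromℤ k ≈ ⟨ a , v j ⟩
      k≈ = proj₂ (pairing-integral a z) ⟫ sym (pairing-cong a v≋)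

  -- Fine adjoint polytopes

  Admissible : ∀ {d} → Subset d → Carrier → Set
  Admissible P s = 0# < s × Satisfiable (fineAdjoint P s)

  -- The support value in `fineAdjoint` is attained on `P`, so it dominates every lower bound `m`;
  -- the exact minimum need not be computed.
  fineAdjoint-≥ : ∀ {d} (P : Subset d) {s m} y → fineAdjoint P s y → ∀ a → ¬ (∀ i → a i ≡ 0ℤ) →
    (∀ x → P x → m ≤ ⟨ a , x ⟩) → m + s ≤ ⟨ a , y ⟩
  fineAdjoint-≥ P y y∈ a a≢0 m≤ with y∈ a a≢0
  ... | h , ((x , x∈P , ax≈h) , _) , h+s≤ =
    ≤-trans (+-mono-≤ (≤-respʳ-≈ ax≈h (m≤ x x∈P)) ≤-refl) h+s≤

  admissible-≤ : ∀ {d} (P : Subset d) {s s′} → Admissible P s → 0# < s′ → s′ ≤ s → Admissible P s′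
  admissible-≤ P (_ , x , x∈) 0<s′ s′≤s = 0<s′ , x , λ a a≢0 →
    let h , supp , h+s≤ = x∈ a a≢0 in h , supp , ≤-trans (+-mono-≤ ≤-refl s′≤s) h+s≤

  -- Uniform lower bound on the lattice width

  ∣_∣ : Carrier → Carrier
  ∣ x ∣ with total 0# x
  ... | inj₁ _ = x
  ... | inj₂ _ = - x

  0≤∣x∣ : ∀ x → 0# ≤ ∣ x ∣
  0≤∣x∣ x with total 0# x
  ... | inj₁ 0≤x = 0≤x
  ... | inj₂ x≤0 = ≤-respʳ-≈ (+-identityˡ (- x)) (x≤y⇒0≤y-x x≤0)

  0≤∣x∣-x : ∀ x → 0# ≤ ∣ x ∣ - x
  0≤∣x∣-x x with total 0# x
  ... | inj₁ 0≤x = ≤-reflexive (sym (-‿inverseʳ x))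
  ... | inj₂ x≤0 = ≤-respʳ-≈ (solve 1 (λ x → con (+ 0) :- x :+ (con (+ 0) :- x) := :- x :- x) refl x)
                             (0≤x+y (x≤y⇒0≤y-x x≤0) (x≤y⇒0≤y-x x≤0))

  0≤∣x∣+x : ∀ x → 0# ≤ ∣ x ∣ + x
  0≤∣x∣+x x with total 0# x
  ... | inj₁ 0≤x = 0≤x+y 0≤x 0≤x
  ... | inj₂ x≤0 = ≤-reflexive (sym (-‿inverseˡ x))

  -- `C` is the total absolute weight of `x` as an affine combination of points of `P`. The excess
  -- of `⟨ a , x ⟩` over `h` is the same combination of excesses between 0 and `D`, so its absolute
  -- value is at most `C * D`. As `C` is fixed before `a`, the bound is uniform in the functional.
  aff-bounded : ∀ {d} (P : Subset d) {x} → aff P x → ∃[ C ] 0# ≤ C × (∀ a {h D} →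
    (∀ y → P y → h ≤ ⟨ a , y ⟩) → (∀ y → P y → ⟨ a , y ⟩ - h ≤ D) →
    0# ≤ C * D - (⟨ a , x ⟩ - h) × 0# ≤ C * D + (⟨ a , x ⟩ - h))
  aff-bounded P {x} (n , p , w , p∈P , ∑w≈1 , x≋) = sum ∣w∣ , 0≤sum (λ j → 0≤∣x∣ (w j)) , bounds
    where
    ∣w∣ : Vector Carrier n
    ∣w∣ j = ∣ w j ∣
    bounds : ∀ a {h D} → (∀ y → P y → h ≤ ⟨ a , y ⟩) → (∀ y → P y → ⟨ a , y ⟩ - h ≤ D) →
      0# ≤ sum ∣w∣ * D - (⟨ a , x ⟩ - h) × 0# ≤ sum ∣w∣ * D + (⟨ a , x ⟩ - h)
    bounds a {h} {D} h≤ ≤D =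
        ≤-respʳ-≈ (+-cong (sym (*-distribʳ-sum D ∣w∣)) (-‿cong excess))
          (x≤y⇒0≤y-x (sum-mono-≤ (λ j → ≤-by-difference
            (0≤x+y (*-nonNegative (0≤∣x∣-x (w j)) (0≤g j)) (*-nonNegative (0≤∣x∣ (w j)) (0≤D-g j)))
            (solve 4 (λ v w g D → v :* D :- w :* g := (v :- w) :* g :+ v :* (D :- g))
              refl ∣ w j ∣ (w j) (g j) D))))
      , ≤-respʳ-≈ (∑-distrib-+ (λ j → ∣w∣ j * D) (λ j → w j * g j)
                   ⟫ +-cong (sym (*-distribʳ-sum D ∣w∣)) excess)
          (0≤sum (λ j → ≤-respʳ-≈
            (solve 4 (λ v w g D → (v :+ w) :* g :+ v :* (D :- g) := v :* D :+ w :* g)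
              refl ∣ w j ∣ (w j) (g j) D)
            (0≤x+y (*-nonNegative (0≤∣x∣+x (w j)) (0≤g j)) (*-nonNegative (0≤∣x∣ (w j)) (0≤D-g j)))))
      where
      g : Vector Carrier n
      g j = ⟨ a , p j ⟩ - h
      0≤g : ∀ j → 0# ≤ g j
      0≤g j = x≤y⇒0≤y-x (h≤ (p j) (p∈P j))
      0≤D-g : ∀ j → 0# ≤ D - g j
      0≤D-g j = x≤y⇒0≤y-x (≤D (p j) (p∈P j))
      excess : sum (λ j → w j * g j) ≈ ⟨ a , x ⟩ - h
      excess = weighted-shift w (λ j → ⟨ a , p j ⟩) ∑w≈1 h
        ⟫ +-congʳ (sym (pairing-cong a x≋ ⟫ pairing-combination a w p))

  0<sum-ones : ∀ n → 0# < sum (replicate (suc n) 1#)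
  0<sum-ones n = 0<x+y 0<1 (0≤sum {n} (λ _ → 0≤1))

  private
    -- Triangle inequality through `h`: the values `a` at a basis vector and `0#` at the origin are
    -- within `C * D` and `C₀ * D` of `h`, yet differ by at least 1.
    1≤∣a∣⇒1≤[C+C₀]D : ∀ {C C₀ D a h} → 1# ≤ a ⊎ 1# ≤ - a →
      0# ≤ C * D - (a - h) × 0# ≤ C * D + (a - h) →
      0# ≤ C₀ * D - (0# - h) × 0# ≤ C₀ * D + (0# - h) → 1# ≤ (C + C₀) * D
    1≤∣a∣⇒1≤[C+C₀]D {C} {C₀} {D} {a} {h} (inj₁ 1≤a) (upper , _) (_ , lower₀) = ≤-by-difference
      (0≤x+y (0≤x+y upper lower₀) (x≤y⇒0≤y-x 1≤a))
      (solve 5 (λ C C₀ D a h → (C :+ C₀) :* D :- con (+ 1)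
          := C :* D :- (a :- h) :+ (C₀ :* D :+ (con (+ 0) :- h)) :+ (a :- con (+ 1)))
        refl C C₀ D a h)
    1≤∣a∣⇒1≤[C+C₀]D {C} {C₀} {D} {a} {h} (inj₂ 1≤-a) (_ , lower) (upper₀ , _) = ≤-by-difference
      (0≤x+y (0≤x+y lower upper₀) (x≤y⇒0≤y-x 1≤-a))
      (solve 5 (λ C C₀ D a h → (C :+ C₀) :* D :- con (+ 1)
          := C :* D :+ (a :- h) :+ (C₀ :* D :- (con (+ 0) :- h)) :+ (:- a :- con (+ 1)))
        refl C C₀ D a h)

    1≤KD⇒h+κ/K≤A : ∀ {κ K D A h} → 0# ≤ κ → 0# < K → 1# ≤ K * D → κ * D ≈ A - h → h + κ * K ⁻¹ ≤ A
    1≤KD⇒h+κ/K≤A {κ} {K} {D} {A} {h} 0≤κ 0<K 1≤KD κD≈A-h = ≤-by-difference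
      (*-nonNegative 0≤κ (*-nonNegative (0≤⁻¹ 0<K) (x≤y⇒0≤y-x 1≤KD)))
      (solve 3 (λ A h e → A :- (h :+ e) := A :- h :- e) refl A h (κ * K ⁻¹)
       ⟫ +-congʳ (sym κD≈A-h)
       ⟫ sym (absorb (κ * D) (κ * D - κ * K ⁻¹) (0<⇒*⁻¹ 0<K))
       ⟫ solve 4 (λ κ D K L → κ :* D :- κ :* L :+ κ :* D :* (K :* L :- con (+ 1))
                   := κ :* (L :* (K :* D :- con (+ 1)))) refl κ D K (K ⁻¹))

  -- The largest excess is attained at a generator and is at most the sum of all of them, as none is
  -- negative. The sum replaces the maximum because it is proportional to the excess at the
  -- barycentre.
  excess-≤-total : ∀ {d n} (v : Vector (Point d) n) (a : Vector ℤ d) h →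
    (∀ k → h ≤ ⟨ a , v k ⟩) → ∀ {y} → conv (Generated v) y →
    ⟨ a , y ⟩ - h ≤ sum (λ k → ⟨ a , v k ⟩ - h)
  excess-≤-total v a h h≤ {y} y∈ = ≤-by-difference
    (x≤y⇒0≤y-x (conv-≤ (Generated v) a generator-≤ y∈))
    (solve 3 (λ D h z → D :- (z :- h) := D :+ h :- z) refl D h ⟨ a , y ⟩)
    where
    D = sum (λ k → ⟨ a , v k ⟩ - h)
    generator-≤ : ∀ z → Generated v z → ⟨ a , z ⟩ ≤ D + h
    generator-≤ z (k , z≋) = ≤-respˡ-≈ (sym (pairing-cong a z≋))
      (≤-by-difference (x≤y⇒0≤y-x (term≤sum (λ k → x≤y⇒0≤y-x (h≤ k)) k))
        (solve 3 (λ D h z → D :+ h :- z := D :- (z :- h)) refl D h ⟨ a , v k ⟩))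

  -- a i is the difference of the values of ⟨ a , _ ⟩ at basis i and at the
  -- origin; K comes from writing these points as affine combinations of P.
  fullDimensional⇒width : ∀ {d} (P : Subset d) → FullDimensional P →
    ∃[ K ] 0# < K × (∀ a → ¬ (∀ i → a i ≡ 0ℤ) → ∀ {h D} → 0# ≤ D →
      (∀ y → P y → h ≤ ⟨ a , y ⟩) → (∀ y → P y → ⟨ a , y ⟩ - h ≤ D) → 1# ≤ K * D)
  fullDimensional⇒width {d} P full = K , 0<x+y 0<1 (0≤sum 0≤Kᵢ) , 1≤KD
    where
    origin = aff-bounded P (full (replicate d 0#))
    axis   = λ i → aff-bounded P (full (basis i))
    Kᵢ : Fin d → Carrier
    Kᵢ i = proj₁ (axis i) + proj₁ origin
    0≤Kᵢ : ∀ i → 0# ≤ Kᵢ i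
    0≤Kᵢ i = 0≤x+y (proj₁ (proj₂ (axis i))) (proj₁ (proj₂ origin))
    -- The sum dominates the constant of whichever coordinate of `a` is nonzero; the summand `1#`
    -- makes `K` positive.
    K = 1# + sum Kᵢ
    resp : ∀ {z A B} h → A ≈ B →
      0# ≤ z - (A - h) × 0# ≤ z + (A - h) → 0# ≤ z - (B - h) × 0# ≤ z + (B - h)
    resp h A≈B (upper , lower) =
      ≤-respʳ-≈ (+-congˡ (-‿cong (+-congʳ A≈B))) upper , ≤-respʳ-≈ (+-congˡ (+-congʳ A≈B)) lower
    1≤KD : ∀ a → ¬ (∀ i → a i ≡ 0ℤ) → ∀ {h D} → 0# ≤ D →
      (∀ y → P y → h ≤ ⟨ a , y ⟩) → (∀ y → P y → ⟨ a , y ⟩ - h ≤ D) → 1# ≤ K * D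
    1≤KD a a≢0 {h} {D} 0≤D h≤ ≤D with ¬∀⟶∃¬ d (λ i → a i ≡ 0ℤ) (λ i → a i ℤₚ.≟ 0ℤ) a≢0
    ... | i , aᵢ≢0 = ≤-trans
      (1≤∣a∣⇒1≤[C+C₀]D (nonZero⇒1≤∣fromℤ∣ (a i) aᵢ≢0)
        (resp h (pairing-basis a i) (proj₂ (proj₂ (axis i)) a h≤ ≤D))
        (resp h (pairing-zeroʳ a) (proj₂ (proj₂ origin) a h≤ ≤D)))
      (≤-by-difference (*-nonNegative (0≤x+y 0≤1 (x≤y⇒0≤y-x (term≤sum 0≤Kᵢ i))) 0≤D)
        (solve 3 (λ S k D → (con (+ 1) :+ S) :* D :- k :* D := (con (+ 1) :+ (S :- k)) :* D)
          refl (sum Kᵢ) (Kᵢ i) D))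

  -- A positive level at the barycentre

  barycentre : ∀ {d n} → Carrier → Vector (Point d) n → Point d
  barycentre κ v = combination (λ _ → κ) v

  barycentre-excess : ∀ {d n} κ (v : Vector (Point d) n) → sum {n} (λ _ → κ) ≈ 1# →
    ∀ (a : Vector ℤ d) h → κ * sum (λ k → ⟨ a , v k ⟩ - h) ≈ ⟨ a , barycentre κ v ⟩ - h
  barycentre-excess κ v ∑κ≈1 a h =
    *-distribˡ-sum κ (λ k → ⟨ a , v k ⟩ - h)
    ⟫ weighted-shift (λ _ → κ) (λ k → ⟨ a , v k ⟩) ∑κ≈1 h
    ⟫ +-congʳ (sym (pairing-combination a (λ _ → κ) v))

  -- With `D` the total excess of the generators, the excess at the barycentre is `κ * D`, and the
  -- width bound `1# ≤ K * D` makes this at least `κ / K` for all nonzero `a` simultaneously.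
  barycentre-admissible : ∀ {d n} (P : Subset d) (v : Vector (Point d) n) → P ≐ conv (Generated v) →
    FullDimensional P → HasIntegralSupport P → ∀ κ → 0# < κ → sum {n} (λ _ → κ) ≈ 1# →
    Satisfiable (Admissible P)
  barycentre-admissible P v (P⊆ , P⊇) full supp κ 0<κ ∑κ≈1 = admissible (fullDimensional⇒width P full)
    where
    admissible : _ → Satisfiable (Admissible P)
    admissible (K , 0<K , 1≤KD) = κ * K ⁻¹ , 0<* 0<κ (0<⁻¹ 0<K) , barycentre κ v , λ a a≢0 →
      let k , supp-k = supp a in fromℤ k , supp-k , barycentre∈ a a≢0 (fromℤ k) (proj₂ supp-k)
      where
      barycentre∈ : ∀ a → ¬ (∀ i → a i ≡ 0ℤ) → ∀ h → (∀ y → P y → h ≤ ⟨ a , y ⟩) →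
        h + κ * K ⁻¹ ≤ ⟨ a , barycentre κ v ⟩
      barycentre∈ a a≢0 h h≤ = 1≤KD⇒h+κ/K≤A (proj₁ 0<κ) 0<K
        (1≤KD a a≢0 (0≤sum (λ k → x≤y⇒0≤y-x (h≤v k))) h≤
          (λ y y∈P → excess-≤-total v a h h≤v (P⊆ y∈P)))
        (barycentre-excess κ v ∑κ≈1 a h)
        where
        h≤v : ∀ k → h ≤ ⟨ a , v k ⟩
        h≤v k = h≤ (v k) (P⊇ (∈-conv (Generated v) (k , λ _ → refl)))

  equal-weights : ∀ n → ∃[ κ ] 0# < κ × sum {suc n} (λ _ → κ) ≈ 1#
  equal-weights n = κ , 0<⁻¹ (0<sum-ones n) ,
    (sum-cong-≋ {suc n} (λ _ → sym (*-identityˡ κ)) ⟫ sym (*-distribʳ-sum κ (replicate (suc n) 1#))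
     ⟫ 0<⇒*⁻¹ (0<sum-ones n))
    where κ = sum (replicate (suc n) 1#) ⁻¹

  fullDimensional⇒admissible : ∀ {d} (P : Subset d) → IsPolytope P → FullDimensional P →
    HasIntegralSupport P → Satisfiable (Admissible P)
  fullDimensional⇒admissible P (zero , v , P⊆ , _) full _
    with conv-inhabited (Generated v) (P⊆ (proj₂ (fullDimensional⇒inhabited P full)))
  ... | _ , () , _
  fullDimensional⇒admissible P (suc n , v , P≐) full supp =
    let κ , 0<κ , ∑κ≈1 = equal-weights n in
    barycentre-admissible P v P≐ full supp κ 0<κ ∑κ≈1

  -- Coordinate functionals and boundedness of the levels

  pairing-axis : ∀ {d} k {a : Vector ℤ d} → (∀ i → a i ≡ 0ℤ) → ∀ x → ⟨ k ∷ a , x ⟩ ≈ fromℤ k * x zero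
  pairing-axis k a≡0 x = +-congˡ (pairing-zeroˡ a≡0 (tail x)) ⟫ +-identityʳ _

  private
    width-bound : ∀ {h₊ h₋ s e x} → 0# ≤ s → h₊ + s ≤ e * x → h₋ + s ≤ - e * x → s ≤ - h₊ - h₋
    width-bound {h₊} {h₋} {s} {e} {x} 0≤s ≤₊ ≤₋ = ≤-by-difference
      (0≤x+y 0≤s (0≤x+y (x≤y⇒0≤y-x ≤₊) (x≤y⇒0≤y-x ≤₋)))
      (solve 5 (λ h k s x u → :- h :- k :- s := s :+ (u :* x :- (h :+ s) :+ (:- u :* x :- (k :+ s))))
        refl h₊ h₋ s x e)

  -- Adding the conditions for the first coordinate and its negative cancels the point and leaves
  -- twice `s` below the width of `P` in that direction. A first coordinate exists only in positive
  -- dimension.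
  admissible-bounded : ∀ {d} (P : Subset (suc d)) → HasIntegralSupport P →
    Satisfiable (UpperBound (Admissible P))
  admissible-bounded {d} P supp = - h (+ 1) - h -[1+ 0 ] , λ s ((0≤s , _) , x , x∈) →
    width-bound 0≤s (axis-≥ x x∈ (+ 1) λ ()) (axis-≥ x x∈ -[1+ 0 ] λ ())
    where
    axis : ℤ → Vector ℤ (suc d)
    axis k = k ∷ replicate d 0ℤ
    h : ℤ → Carrier
    h k = fromℤ (proj₁ (supp (axis k)))
    axis-≥ : ∀ {s} x → fineAdjoint P s x → ∀ k → ¬ k ≡ 0ℤ → h k + s ≤ fromℤ k * x zero
    axis-≥ x x∈ k k≢0 = ≤-respʳ-≈ (pairing-axis k (λ _ → ≡.refl) x)
      (fineAdjoint-≥ P x x∈ (axis k) (λ e≡0 → k≢0 (e≡0 zero)) (proj₂ (proj₂ (supp (axis k)))))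

  -- Pyramids

  Base⊎Apex : ∀ {d} → Subset d → Subset (suc d)
  Base⊎Apex {d} P q = (∃[ x ] P x × q ≋ (1# ∷ x)) ⊎ q ≋ replicate (suc d) 0#

  -- It suffices to test the generators: the apex contributes `m ≤ 0#`, and the points `1# ∷ x`
  -- contribute the other condition.
  pyr-≥ : ∀ {d} (P : Subset d) (c : Vector ℤ (suc d)) {m} → m ≤ 0# →
    (∀ x → P x → m ≤ fromℤ (c zero) + ⟨ tail c , x ⟩) → ∀ y → Pyr P y → m ≤ ⟨ c , y ⟩
  pyr-≥ P c {m} m≤0 m≤ y = conv-≥ (Base⊎Apex P) c generator-≥
    where
    generator-≥ : ∀ y → Base⊎Apex P y → m ≤ ⟨ c , y ⟩
    generator-≥ y (inj₁ (x , x∈P , y≋)) =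
      ≤-respʳ-≈ (sym (pairing-cong c y≋ ⟫ +-congʳ (*-identityʳ _))) (m≤ x x∈P)
    generator-≥ y (inj₂ y≋) = ≤-respʳ-≈ (sym (pairing-cong c y≋ ⟫ pairing-zeroʳ c)) m≤0

  private
    rescale-≤ : ∀ {t s k A} → 0# < t → 0# + s ≤ - k * t + A → k + t ⁻¹ * s ≤ t ⁻¹ * A
    rescale-≤ {t} {s} {k} {A} 0<t s≤ = ≤-by-difference
      (*-nonNegative (0≤⁻¹ 0<t) (x≤y⇒0≤y-x s≤))
      (solve 5 (λ t u s k A → u :* A :- (k :+ u :* s)
                 := u :* (:- k :* t :+ A :- (con (+ 0) :+ s)) :+ k :* (t :* u :- con (+ 1)))
         refl t (t ⁻¹) s k A
       ⟫ absorb k _ (0<⇒*⁻¹ 0<t))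

  pyr-admissible⇒admissible : ∀ {d} (P : Subset d) → HasIntegralSupport P → ∀ {s} →
    Admissible (Pyr P) s → ∃[ t ] 0# < t × s ≤ t × t + s ≤ 1# × Admissible P (t ⁻¹ * s)
  pyr-admissible⇒admissible {d} P supp {s} (0<s , y , y∈) =
    t , 0<t , s≤t , t+s≤1 , 0<* (0<⁻¹ 0<t) 0<s , (λ i → t ⁻¹ * y (suc i)) , scaled∈
    where
    t = y zero
    zeros : Vector ℤ d
    zeros = replicate d 0ℤ
    zeros≈0 : ∀ x → ⟨ zeros , x ⟩ ≈ 0#
    zeros≈0 = pairing-zeroˡ {a = zeros} (λ _ → ≡.refl)
    s≤t : s ≤ t
    s≤t = ≤-respˡ-≈ (+-identityˡ s) (≤-respʳ-≈
      (pairing-axis (+ 1) {zeros} (λ _ → ≡.refl) y ⟫ *-congʳ (+-identityʳ 1#) ⟫ *-identityˡ t)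
      (fineAdjoint-≥ (Pyr P) y y∈ (+ 1 ∷ zeros) (λ e≡0 → case e≡0 zero of λ ())
        (pyr-≥ P (+ 1 ∷ zeros) ≤-refl (λ x _ →
          ≤-respʳ-≈ (sym (+-cong (+-identityʳ 1#) (zeros≈0 x) ⟫ +-identityʳ 1#)) 0≤1))))
    0<t : 0# < t
    0<t = 0<-≤-trans 0<s s≤t
    -1≤0 : - 1# ≤ 0#
    -1≤0 = ≤-by-difference 0≤1 (solve 0 (con (+ 0) :- :- con (+ 1) := con (+ 1)) refl)
    -1+s≤-t : - 1# + s ≤ - t
    -1+s≤-t = ≤-respʳ-≈
      (pairing-axis -[1+ 0 ] {zeros} (λ _ → ≡.refl) y ⟫ *-congʳ (-‿cong (+-identityʳ 1#))
       ⟫ solve 1 (λ t → :- con (+ 1) :* t := :- t) refl t)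
      (fineAdjoint-≥ (Pyr P) y y∈ (-[1+ 0 ] ∷ zeros) (λ e≡0 → case e≡0 zero of λ ())
        (pyr-≥ P (-[1+ 0 ] ∷ zeros) -1≤0 (λ x _ → ≤-reflexive
          (sym (+-cong (-‿cong (+-identityʳ 1#)) (zeros≈0 x) ⟫ +-identityʳ (- 1#))))))
    t+s≤1 : t + s ≤ 1#
    t+s≤1 = ≤-by-difference (x≤y⇒0≤y-x -1+s≤-t)
      (solve 2 (λ t s → con (+ 1) :- (t :+ s) := :- t :- (:- con (+ 1) :+ s)) refl t s)
    scaled∈ : fineAdjoint P (t ⁻¹ * s) (λ i → t ⁻¹ * y (suc i))
    scaled∈ a a≢0 = let k , supp-k = supp a in
      fromℤ k , supp-k , ≤-respʳ-≈ (sym (pairing-scale a (t ⁻¹) (tail y)))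
        (rescale-≤ 0<t (≤-respʳ-≈ (+-congʳ (*-congʳ (fromℤ-neg k)))
          (fineAdjoint-≥ (Pyr P) y y∈ (ℤ.- k ∷ a) (λ c≡0 → a≢0 (c≡0 ∘ suc))
            (pyr-≥ P (ℤ.- k ∷ a) ≤-refl (λ x x∈P →
              ≤-respʳ-≈ (+-comm _ _ ⟫ +-congʳ (sym (fromℤ-neg k)))
                (x≤y⇒0≤y-x (proj₂ supp-k x x∈P)))))))

  -- The minimum over the pyramid is the smaller of 0 at the apex and `fromℤ (c zero) + h` on the
  -- base. The case distinction supplies the point of attainment that `IsSupportValue` demands.
  pyr-support : ∀ {d} (P : Subset d) (c : Vector ℤ (suc d)) {h} → IsSupportValue P (tail c) h →
    ∃[ m ] IsSupportValue (Pyr P) c m × m ≤ 0# × m ≤ fromℤ (c zero) + h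
  pyr-support {d} P c {h} ((x , x∈P , ax≈h) , h≤) with total (fromℤ (c zero) + h) 0#
  ... | inj₁ b+h≤0 = fromℤ (c zero) + h
    , ((1# ∷ x , ∈-conv (Base⊎Apex P) (inj₁ (x , x∈P , λ _ → refl)) , +-cong (*-identityʳ _) ax≈h)
      , pyr-≥ P c b+h≤0 (λ z z∈P → +-mono-≤ ≤-refl (h≤ z z∈P)))
    , b+h≤0 , ≤-refl
  ... | inj₂ 0≤b+h = 0#
    , ((replicate (suc d) 0# , ∈-conv (Base⊎Apex P) (inj₂ (λ _ → refl)) , pairing-zeroʳ c)
      , pyr-≥ P c ≤-refl (λ z z∈P → ≤-trans 0≤b+h (+-mono-≤ ≤-refl (h≤ z z∈P))))
    , ≤-refl , 0≤b+h

  private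
    -- For `b ≥ 1` the minimum is at most 0 and `b * t ≥ t ≥ u`. For `b ≤ -1` it is at most `b`, and
    -- `b * t - b = - b * u ≥ u` because `1 - t = u`.
    vertical-≤ : ∀ {t u m b} → t + u ≈ 1# → 0# ≤ t → 0# ≤ u → u ≤ t → m ≤ 0# → m ≤ b →
      1# ≤ b ⊎ 1# ≤ - b → m + u ≤ b * t
    vertical-≤ {t} {u} {m} {b} _ 0≤t _ u≤t m≤0 _ (inj₁ 1≤b) = ≤-by-difference
      (0≤x+y (0≤x+y (*-nonNegative (x≤y⇒0≤y-x 1≤b) 0≤t) (x≤y⇒0≤y-x u≤t)) (x≤y⇒0≤y-x m≤0))
      (solve 4 (λ t u m b → b :* t :- (m :+ u)
         := (b :- con (+ 1)) :* t :+ (t :- u) :+ (con (+ 0) :- m)) refl t u m b)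
    vertical-≤ {t} {u} {m} {b} t+u≈1 _ 0≤u _ _ m≤b (inj₂ 1≤-b) = ≤-by-difference
      (0≤x+y (x≤y⇒0≤y-x m≤b) (*-nonNegative (x≤y⇒0≤y-x 1≤-b) 0≤u))
      (solve 4 (λ t u m b → b :* t :- (m :+ u)
         := b :- m :+ (:- b :- con (+ 1)) :* u :+ b :* (t :+ u :- con (+ 1))) refl t u m b
       ⟫ absorb b _ t+u≈1)

    -- The lifted point is `t` times a base-height point plus `t * s` times the apex. Splitting `m`
    -- with the same weights gives `m ≤ t * (b + h)`, and `t * s ≤ t * (A - h)` supplies the rest.
    slanted-≤ : ∀ {t s m b h A} → t + t * s ≈ 1# → 0# ≤ t → 0# ≤ t * s → m ≤ 0# → m ≤ b + h →
      h + s ≤ A → m + t * s ≤ b * t + t * A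
    slanted-≤ {t} {s} {m} {b} {h} {A} t+ts≈1 0≤t 0≤ts m≤0 m≤b+h h+s≤A = ≤-by-difference
      (0≤x+y (0≤x+y (*-nonNegative 0≤t (x≤y⇒0≤y-x h+s≤A)) (*-nonNegative 0≤t (x≤y⇒0≤y-x m≤b+h)))
             (*-nonNegative 0≤ts (x≤y⇒0≤y-x m≤0)))
      (solve 6 (λ t s m b h A → b :* t :+ t :* A :- (m :+ t :* s)
         := t :* (A :- (h :+ s)) :+ t :* (b :+ h :- m) :+ t :* s :* (con (+ 0) :- m)
            :+ m :* (t :+ t :* s :- con (+ 1))) refl t s m b h A
       ⟫ absorb m _ t+ts≈1)

  -- Lifting `x` to height `t` scales its level to `t * s`, while the base facet demands
  -- `t + t * s ≤ 1`; the chosen `t` gives equality.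
  admissible⇒pyr-admissible : ∀ {d} (P : Subset d) → HasIntegralSupport P → ∀ {s} → s ≤ 1# →
    Admissible P s → Admissible (Pyr P) ((1# + s) ⁻¹ * s)
  admissible⇒pyr-admissible {d} P supp {s} s≤1 (0<s , x , x∈) =
    0<* (0<⁻¹ 0<1+s) 0<s , t ∷ (λ i → t * x i) , lifted∈
    where
    t = (1# + s) ⁻¹
    0<1+s : 0# < 1# + s
    0<1+s = 0<x+y 0<1 (proj₁ 0<s)
    0≤t : 0# ≤ t
    0≤t = 0≤⁻¹ 0<1+s
    0≤ts : 0# ≤ t * s
    0≤ts = *-nonNegative 0≤t (proj₁ 0<s)
    t+ts≈1 : t + t * s ≈ 1#
    t+ts≈1 = solve 2 (λ t s → t :+ t :* s := (con (+ 1) :+ s) :* t) refl t s ⟫ 0<⇒*⁻¹ 0<1+s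
    ts≤t : t * s ≤ t
    ts≤t = ≤-respʳ-≈ (*-identityʳ t) (*-monoˡ-≤ 0≤t s≤1)
    lifted∈ : fineAdjoint (Pyr P) (t * s) (t ∷ (λ i → t * x i))
    lifted∈ c c≢0 with supp (tail c)
    ... | k , supp-k with pyr-support P c supp-k
    ... | m , supp-m , m≤0 , m≤b+k = m , supp-m , m+ts≤
      where
      m+ts≤ : m + t * s ≤ ⟨ c , (t ∷ (λ i → t * x i)) ⟩
      -- If the tail of `c` vanishes, membership of `x` says nothing about `c`; here `s ≤ 1#`
      -- enters, through `ts≤t`.
      m+ts≤ with all? (λ i → tail c i ℤₚ.≟ 0ℤ)
      ... | yes a≡0 = ≤-respʳ-≈ (sym (pairing-axis (c zero) a≡0 (t ∷ (λ i → t * x i))))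
        (vertical-≤ t+ts≈1 0≤t 0≤ts ts≤t m≤0 (≤-respʳ-≈ (+-congˡ k≈0 ⟫ +-identityʳ _) m≤b+k)
          (nonZero⇒1≤∣fromℤ∣ (c zero) (λ b≡0 → c≢0 λ { zero → b≡0 ; (suc i) → a≡0 i })))
        where
        k≈0 : fromℤ k ≈ 0#
        k≈0 = let (z , _ , az≈k) , _ = supp-k in sym az≈k ⟫ pairing-zeroˡ a≡0 z
      ... | no a≢0 = ≤-respʳ-≈ (+-congˡ (sym (pairing-scale (tail c) t x)))
        (slanted-≤ t+ts≈1 0≤t 0≤ts m≤0 m≤b+k (fineAdjoint-≥ P x x∈ (tail c) a≢0 (proj₂ supp-k)))

  zeroDimensional⇒admissible : (P : Subset 0) → ∀ {s} → 0# < s → Admissible P s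
  zeroDimensional⇒admissible P 0<s = 0<s , (λ ()) , λ a a≢0 → ⊥-elim (a≢0 λ ())

  -- The ℚ-codegree of a pyramid

  open MaxProperties totalOrder using (x≤x⊔y; x≤y⊔x; ⊔-sel)

  private
    1≤2 : 1# ≤ 1# + 1#
    1≤2 = ≤-respˡ-≈ (+-identityʳ 1#) (+-mono-≤ ≤-refl 0≤1)

    *-assoc-1 : ∀ {x y z} → x * y ≈ 1# → x * (y * z) ≈ z
    *-assoc-1 xy≈1 = sym (*-assoc _ _ _) ⟫ *-congʳ xy≈1 ⟫ *-identityˡ _

    ⁻¹-unique : ∀ {x y} → x * y ≈ 1# → x ⁻¹ ≈ y
    ⁻¹-unique {x} {y} xy≈1 =
      sym (*-identityʳ _) ⟫ *-congˡ (sym xy≈1) ⟫ *-assoc-1 (*-comm _ _ ⟫ *-inverse x≉0)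
      where
      x≉0 : ¬ x ≈ 0#
      x≉0 x≈0 = 0≉1 (sym (zeroˡ y) ⟫ *-congʳ (sym x≈0) ⟫ xy≈1)

    x≤y*z⁻¹ : ∀ {x y z} → 0# < z → x * z ≤ y → x ≤ z ⁻¹ * y
    x≤y*z⁻¹ {x} {y} {z} 0<z xz≤y =
      ≤-respˡ-≈ (*-congˡ (*-comm x z) ⟫ *-assoc-1 (*-comm _ _ ⟫ 0<⇒*⁻¹ 0<z))
                (*-monoˡ-≤ (0≤⁻¹ 0<z) xz≤y)

  sup-*-≤ : ∀ S {c b} → Satisfiable S → Satisfiable (UpperBound S) → 0# < c →
    (∀ s → S s → s * c ≤ b) → sup S * c ≤ b
  sup-*-≤ S {c} {b} inh bdd 0<c ≤b = ≤-respˡ-≈ (*-comm c (sup S)) (≤-respʳ-≈ (*-assoc-1 (0<⇒*⁻¹ 0<c))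
    (*-monoˡ-≤ (proj₁ 0<c) (sup-least S inh bdd (c ⁻¹ * b) (λ s s∈S → x≤y*z⁻¹ 0<c (≤b s s∈S)))))

  module Codegree {d} (P : Subset d) (supp : HasIntegralSupport P) where

    S T : Carrier → Set
    S = Admissible P
    T = Admissible (Pyr P)
    τ = sup T

    T-upper : ∀ s → T s → s * (1# + 1#) ≤ 1#
    T-upper s s∈T = let t , _ , s≤t , t+s≤1 , _ = pyr-admissible⇒admissible P supp s∈T in
      ≤-by-difference (0≤x+y (x≤y⇒0≤y-x s≤t) (x≤y⇒0≤y-x t+s≤1))
      (solve 2 (λ s t → con (+ 1) :- s :* (con (+ 1) :+ con (+ 1)) := t :- s :+ (con (+ 1) :- (t :+ s)))
        refl s t)

    T-bounded : Satisfiable (UpperBound T)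
    T-bounded = 1# , λ s s∈T → ≤-trans
      (≤-by-difference (proj₁ (proj₁ s∈T))
        (solve 1 (λ s → s :* (con (+ 1) :+ con (+ 1)) :- s := s) refl s))
      (T-upper s s∈T)

    -- The bound `s / (1 + s) ≤ τ` with its denominator cleared, so that it is linear in `s` and
    -- passes to suprema.
    S⇒≤τ : ∀ {s} → s ≤ 1# → S s → s ≤ τ * (1# + s)
    S⇒≤τ {s} s≤1 s∈S = ≤-respˡ-≈ (*-assoc-1 (0<⇒*⁻¹ 0<1+s)) (≤-respʳ-≈ (*-comm _ _)
      (*-monoˡ-≤ (proj₁ 0<1+s) (sup-upper T (_ , s′∈T) T-bounded _ s′∈T)))
      where
      s′∈T = admissible⇒pyr-admissible P supp s≤1 s∈S
      0<1+s : 0# < 1# + s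
      0<1+s = 0<x+y 0<1 (proj₁ (proj₁ s∈S))

    T-inhabited : Satisfiable S → Satisfiable T
    T-inhabited (s , s∈S) with total s 1#
    ... | inj₁ s≤1 = _ , admissible⇒pyr-admissible P supp s≤1 s∈S
    ... | inj₂ 1≤s = _ , admissible⇒pyr-admissible P supp ≤-refl (admissible-≤ P s∈S 0<1 1≤s)

    -- The maximum equals one of its arguments, so the upper bound must hold for both, whereas a
    -- lower bound for either one suffices. Leaving `μ` arbitrary covers both `1 / σ` and the
    -- default value in dimension 0.
    τ⁻¹≈ : ∀ μ → Satisfiable S → (∀ s → T s → s * (μ + 1#) ≤ 1#) →
      1# ≤ τ * (1# + 1#) ⊎ 1# ≤ τ * (μ + 1#) → τ ⁻¹ ≈ (1# + 1#) ⊔ (μ + 1#)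
    τ⁻¹≈ μ S-inh upper lower = ⁻¹-unique (antisym τM≤1 1≤τM)
      where
      M = (1# + 1#) ⊔ (μ + 1#)
      2≤M : 1# + 1# ≤ M
      2≤M = x≤x⊔y (1# + 1#) (μ + 1#)
      T-inh : Satisfiable T
      T-inh = T-inhabited S-inh
      0≤τ : 0# ≤ τ
      0≤τ = let s , s∈T = T-inh in ≤-trans (proj₁ (proj₁ s∈T)) (sup-upper T T-inh T-bounded s s∈T)
      T-upper-M : ∀ s → T s → s * M ≤ 1#
      T-upper-M s s∈T with ⊔-sel (1# + 1#) (μ + 1#)
      ... | inj₁ M≈ = ≤-respˡ-≈ (*-congˡ (sym M≈)) (T-upper s s∈T)
      ... | inj₂ M≈ = ≤-respˡ-≈ (*-congˡ (sym M≈)) (upper s s∈T)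
      τM≤1 : τ * M ≤ 1#
      τM≤1 = sup-*-≤ T T-inh T-bounded (0<-≤-trans 0<1 (≤-trans 1≤2 2≤M)) T-upper-M
      1≤τM : 1# ≤ τ * M
      1≤τM = [ (λ 1≤2τ → ≤-trans 1≤2τ (*-monoˡ-≤ 0≤τ 2≤M))
             , (λ 1≤ → ≤-trans 1≤ (*-monoˡ-≤ 0≤τ (x≤y⊔x (1# + 1#) (μ + 1#)))) ]′ lower

    module Bounded (S-inh : Satisfiable S) (S-bdd : Satisfiable (UpperBound S)) where

      σ = sup S
      μ = σ ⁻¹

      0<σ : 0# < σ
      0<σ = let s , s∈S = S-inh in 0<-≤-trans (proj₁ s∈S) (sup-upper S S-inh S-bdd s s∈S)

      σμ≈1 : σ * μ ≈ 1#
      σμ≈1 = 0<⇒*⁻¹ 0<σ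

      -- For a pyramid point of height `t`, `s / t ≤ σ` means `μ * s ≤ t`; adding `t + s ≤ 1`
      -- eliminates the unknown height.
      upper : ∀ s → T s → s * (μ + 1#) ≤ 1#
      upper s s∈T =
        let t , 0<t , _ , t+s≤1 , s/t∈S = pyr-admissible⇒admissible P supp s∈T in ≤-by-difference
        (0≤x+y (*-nonNegative (0≤⁻¹ 0<σ) (x≤y⇒0≤y-x (s≤tσ s 0<t s/t∈S))) (x≤y⇒0≤y-x t+s≤1))
        (solve 4 (λ s t σ μ → con (+ 1) :- s :* (μ :+ con (+ 1))
            := μ :* (t :* σ :- s) :+ (con (+ 1) :- (t :+ s)) :+ (:- t) :* (σ :* μ :- con (+ 1)))
          refl s t σ μ
         ⟫ absorb (- t) _ σμ≈1)
        where
        s≤tσ : ∀ s {t} → 0# < t → S (t ⁻¹ * s) → s ≤ t * σ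
        s≤tσ s 0<t s/t∈S = ≤-respˡ-≈ (*-assoc-1 (0<⇒*⁻¹ 0<t))
          (*-monoˡ-≤ (proj₁ 0<t) (sup-upper S S-inh S-bdd _ s/t∈S))

      -- If 1 ∉ S then every s ∈ S satisfies s / (1 + s) ≤ τ, which passes to
      -- the supremum as σ (1 - τ) ≤ τ.
      lower : 1# ≤ τ * (1# + 1#) ⊎ 1# ≤ τ * (μ + 1#)
      lower with 1# ≤? τ * (1# + 1#)
      ... | yes 1≤2τ = inj₁ 1≤2τ
      ... | no  1≰2τ = inj₂ (≤-by-difference
        (*-nonNegative (0≤⁻¹ 0<σ) (x≤y⇒0≤y-x σ[1-τ]≤τ))
        (solve 3 (λ τ σ μ → τ :* (μ :+ con (+ 1)) :- con (+ 1)
            := μ :* (τ :- σ :* (con (+ 1) :- τ)) :+ (con (+ 1) :- τ) :* (σ :* μ :- con (+ 1)))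
          refl τ σ μ
         ⟫ absorb (1# - τ) _ σμ≈1))
        where
        S≤1 : ∀ s → S s → s ≤ 1#
        S≤1 s s∈S with total s 1#
        ... | inj₁ s≤1 = s≤1
        ... | inj₂ 1≤s = ⊥-elim (1≰2τ (S⇒≤τ ≤-refl (admissible-≤ P s∈S 0<1 1≤s)))
        1≰τ : ¬ 1# ≤ τ
        1≰τ 1≤τ = 1≰2τ (≤-trans 1≤τ (≤-by-difference (≤-trans 0≤1 1≤τ)
          (solve 1 (λ τ → τ :* (con (+ 1) :+ con (+ 1)) :- τ := τ) refl τ)))
        0<1-τ : 0# < 1# - τ
        0<1-τ = x≤y⇒0≤y-x (≰⇒≥ 1≰τ) , λ 0≈1-τ → 1≰τ (≤-reflexive (x∙y⁻¹≈ε⇒x≈y 1# τ (sym 0≈1-τ)))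
        σ[1-τ]≤τ : σ * (1# - τ) ≤ τ
        σ[1-τ]≤τ = sup-*-≤ S S-inh S-bdd 0<1-τ (λ s s∈S → ≤-by-difference
          (x≤y⇒0≤y-x (S⇒≤τ (S≤1 s s∈S) s∈S))
          (solve 2 (λ s τ → τ :- s :* (con (+ 1) :- τ) := τ :* (con (+ 1) :+ s) :- s) refl s τ))

      μF-Pyr : μF (Pyr P) ≈ (1# + 1#) ⊔ (μF P + 1#)
      μF-Pyr = τ⁻¹≈ μ S-inh upper lower

  -- All positive levels are admissible, so `sup` takes its default value 0, whose inverse is again
  -- 0.
  μF-zeroDimensional : (P : Subset 0) → μF P ≈ 0#
  μF-zeroDimensional P = 0⁻¹≈0 (sup-unbounded (Admissible P) unbounded)
    where
    unbounded : ¬ Satisfiable (UpperBound (Admissible P))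
    unbounded (u , ≤u) with total u 0#
    ... | inj₁ u≤0 = 1≰0 (≤-trans (≤u 1# (zeroDimensional⇒admissible P 0<1)) u≤0)
    ... | inj₂ 0≤u = 1≰0 (≤-by-difference
      (x≤y⇒0≤y-x (≤u (1# + u) (zeroDimensional⇒admissible P (0<x+y 0<1 0≤u))))
      (solve 1 (λ u → con (+ 0) :- con (+ 1) := u :- (con (+ 1) :+ u)) refl u))

  -- The pyramid over a point is a unit segment. Since `μF P + 1#` is 1, the maximum is 2, and it is
  -- reached because the level 1 of the point lifts to 1/2.
  μF-Pyr-zeroDimensional : (P : Subset 0) → HasIntegralSupport P →
    μF (Pyr P) ≈ (1# + 1#) ⊔ (μF P + 1#)
  μF-Pyr-zeroDimensional P supp = τ⁻¹≈ (μF P) (1# , 1∈S) upper (inj₁ (S⇒≤τ ≤-refl 1∈S))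
    where
    open Codegree P supp
    1∈S = zeroDimensional⇒admissible P 0<1
    upper : ∀ s → T s → s * (μF P + 1#) ≤ 1#
    upper s s∈T = ≤-respˡ-≈
      (sym (*-congˡ (+-congʳ (μF-zeroDimensional P) ⟫ +-identityˡ 1#) ⟫ *-identityʳ s))
      (proj₂ T-bounded s s∈T)

mainTheorem5 :
    (ℝ : CompleteOrderedField) →
    let open CompleteOrderedField ℝ
        open Polytopes ℝ
    in (d : ℕ) (P : Subset d) →
       IsLatticePolytope P →
       FullDimensional P →
       μF (Pyr P) ≈ (1# + 1#) ⊔ (μF P + 1#)
mainTheorem5 ℝ d P lattice@(polytope , _) full = theorem d P polytope full supp
  where
  open CompleteOrderedField ℝ using (_≈_; 1#; _+_; _⊔_)
  open Polytopes ℝ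
  open PyramidCodegree ℝ
  supp : HasIntegralSupport P
  supp = latticePolytope⇒integralSupport P lattice (fullDimensional⇒inhabited P full)
  theorem : ∀ d (P : Subset d) → IsPolytope P → FullDimensional P → HasIntegralSupport P →
    μF (Pyr P) ≈ (1# + 1#) ⊔ (μF P + 1#)
  theorem zero    P _        _    supp = μF-Pyr-zeroDimensional P supp
  theorem (suc d) P polytope full supp = Codegree.Bounded.μF-Pyr P supp
    (fullDimensional⇒admissible P polytope full supp) (admissible-bounded P supp)
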